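{- Let $R$ be a connected $r$-regular graph of order $q$ and diameter at most two. Let $G=G(T,R,p)$ be a loaded tree of $k\ge2$ copies of $R$. Suppose that the maximum port load is exactly $L$ and that every copy $R_i$ contains an unused selector. Then $G$ is connected and \[ |V(G)|=qk,\qquad |E(G)|=\frac{rqk}{2}+k-1,\qquad \Delta(G)=r+L, \] \[ \rho(G)=k,\qquad \tau_D(G)=(q-1)k . \] Moreover, \[ \mu(G)=k\bigl((r+L)^2+3-(L+1)q\bigr)-2, \] and hence \[ \tau_D(G)-\mathsf{B}_{\mathrm{HY}}(G)=\frac{k\bigl((L+1)q-(r+L)^2-3\bigr)+2}{(r+L)^2+1}. \]
   Context: All graphs are finite, simple and undirected. For a graph $G$ write $n=|V(G)|$, $m=|E(G)|$, and $\Delta=\Delta(G)$ for the maximum degree. A set $S\subseteq V(G)$ is an identifying vertex cover if $e\cap S\neq\emptyset$ for every $e\in E(G)$ and the sets $e\cap S$ ($e\in E(G)$) are pairwise distinct; $\tau_D(G)$ is the minimum cardinality of an identifying vertex cover. A packing is a set of vertices whose distinct members are at pairwise distance at least three (vertices in different components have distance $+\infty$); $\rho(G)$ is the maximum cardinality of a packing. Define \[ \mathsf{B}_{\mathrm{HY}}(G)=\frac{\Delta(\Delta-1)n+2m}{\Delta^2+1},\qquad \mu(G)=\Delta(\Delta-1)n+2m-(\Delta^2+1)\tau_D(G). \] Loaded tree of fibres: let $T$ be a tree on the vertex set $[k]=\{1,\dots,k\}$, $k\ge2$, and let $R_1,\dots,R_k$ be vertex-disjoint copies of a graph $R$. For every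 incidence $(i,e)$ with $i\in e\in E(T)$, choose a vertex $p_{i,e}\in V(R_i)$, called its port (different incidences at the same $i$ may use the same or different ports). The load of $v\in V(R_i)$ is $\lambda_i(v)=|\{e\in E(T): i\in e \text{ and } p_{i,e}=v\}|$. The maximum port load is $\max_{i,v}\lambda_i(v)$. A vertex $s_i\in V(R_i)$ with $\lambda_i(s_i)=0$ is an unused selector. The graph $G(T,R,p)$ is obtained from the disjoint union of $R_1,\dots,R_k$ by adding, for every edge $e=ij$ of $T$, the edge $p_{i,e}p_{j,e}$. -}

module Defs where

open import Data.Fin using (Fin; zero; suc; toℕ; inject₁; fromℕ; remQuot)
import Data.Fin as Fin
import Data.Fin.Properties as Fin
open import Data.Fin.Subset using (Subset; inside; outside; _∈_; _∩_; _∪_; ⁅_⁆; ∣_∣; Nonempty)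
open import Data.Fin.Subset.Properties using (nonempty?; _∈?_)
open import Data.Integer as ℤ using (ℤ; +_)
open import Data.List using (List; []; _∷_; map; _++_; filter; length; allFin; cartesianProduct)
open import Data.List.Extrema.Nat using (min; max)
open import Data.List.Relation.Unary.All using (All; all?)
open import Data.List.Relation.Unary.Unique.Propositional using (Unique)
open import Data.List.Relation.Unary.AllPairs using (allPairs?)
open import Data.Nat using (ℕ; zero; suc; _+_; _*_; _^_; _≤_; _<_)
open import Data.Product using (Σ; ∃-syntax; _×_; _,_; uncurry)
open import Data.Rational as ℚ using (ℚ)
open import Data.Sum using (_⊎_; inj₁; inj₂)
import Data.Vec as Vec
import Data.Vec.Properties as Vec
import Data.Bool.Properties as Bool
open import Function using (_on_)
open import Function.Definitions using (Injective)
open import Level using (0ℓ)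
open import Relation.Binary using (Rel; Decidable; Symmetric)
open import Relation.Binary.PropositionalEquality using (_≡_; _≢_; sym)
open import Relation.Nullary using (¬_; Dec; yes; no)
open import Relation.Nullary.Decidable using (_×-dec_; _⊎-dec_; _→-dec_; ¬?)
import Relation.Unary as U

------------------------------------------------------------------------
-- Finite simple graphs

record Graph (n : ℕ) : Set₁ where
  field
    Adj        : Rel (Fin n) 0ℓ
    adj?       : Decidable Adj
    adj-sym    : Symmetric Adj
    adj-irrefl : ∀ {v} → ¬ Adj v v

∣V∣ : ∀ {n} → Graph n → ℕ
∣V∣ {n} _ = n

module _ {n : ℕ} (G : Graph n) where
  open Graph G

  -- The edge {u , v} is represented by the pair of its ends in increasing
  -- order, so each edge is listed exactly once.
  edges : List (Fin n × Fin n)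
  edges = filter (λ (u , v) → (u Fin.<? v) ×-dec adj? u v)
                 (cartesianProduct (allFin n) (allFin n))

  ∣E∣ : ℕ
  ∣E∣ = length edges

  degree : Fin n → ℕ
  degree v = length (filter (adj? v) (allFin n))

  -- The base value 0 matters only for the graph without vertices.
  Δ : ℕ
  Δ = max 0 (map degree (allFin n))

  Regular : ℕ → Set
  Regular r = ∀ v → degree v ≡ r

  Walk : ℕ → Rel (Fin n) 0ℓ
  Walk zero    u v = u ≡ v
  Walk (suc l) u v = ∃[ w ] (Adj u w × Walk l w v)

  walk? : ∀ l → Decidable (Walk l)
  walk? zero    u v = u Fin.≟ v
  walk? (suc l) u v = Fin.any? (λ w → adj? u w ×-dec walk? l w v)

  Connected : Set
  Connected = 0 < n × (∀ u v → ∃[ l ] Walk l u v)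

  -- Distance is the infimum of the lengths of walks, +∞ if there are none.
  Dist≤ : ℕ → Rel (Fin n) 0ℓ
  Dist≤ d u v = ∃[ l ] (l ≤ d × Walk l u v)

  Dist≥ : ℕ → Rel (Fin n) 0ℓ
  Dist≥ d u v = ∀ (l : Fin d) → ¬ Walk (toℕ l) u v

  dist≥? : ∀ d → Decidable (Dist≥ d)
  dist≥? d u v = Fin.all? (λ l → ¬? (walk? (toℕ l) u v))

  Diameter≤ : ℕ → Set
  Diameter≤ d = ∀ u v → Dist≤ d u v

  -- A cycle of length 3 + l, with vertices c 0 , … , c (2 + l).
  IsCycle : ∀ {l} → (Fin (3 + l) → Fin n) → Set
  IsCycle {l} c =
    Injective _≡_ _≡_ c
    × (∀ (i : Fin (2 + l)) → Adj (c (inject₁ i)) (c (suc i)))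
    × Adj (c (fromℕ (2 + l))) (c zero)

  Acyclic : Set
  Acyclic = ∀ l (c : Fin (3 + l) → Fin n) → ¬ IsCycle c

  IsTree : Set
  IsTree = Connected × Acyclic

------------------------------------------------------------------------
-- Identifying vertex covers and packings

subsets : ∀ n → List (Subset n)
subsets zero    = Vec.[] ∷ []
subsets (suc n) = map (inside Vec.∷_) (subsets n) ++ map (outside Vec.∷_) (subsets n)

module _ {n : ℕ} (G : Graph n) where

  trace : Subset n → Fin n × Fin n → Subset n
  trace S (u , v) = (⁅ u ⁆ ∪ ⁅ v ⁆) ∩ S

  IsIdentifyingVertexCover : Subset n → Set
  IsIdentifyingVertexCover S =
    All (λ e → Nonempty (trace S e)) (edges G)
    × Unique (map (trace S) (edges G))

  isIdentifyingVertexCover? : U.Decidable IsIdentifyingVertexCover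
  isIdentifyingVertexCover? S =
    all? (λ e → nonempty? (trace S e)) (edges G)
    ×-dec allPairs? (λ A B → ¬? (Vec.≡-dec Bool._≟_ A B)) (map (trace S) (edges G))

  -- V(G) is itself an identifying vertex cover, so the base value n does
  -- not affect the minimum.
  τD : ℕ
  τD = min n (map ∣_∣ (filter isIdentifyingVertexCover? (subsets n)))

  IsPacking : Subset n → Set
  IsPacking P = ∀ u v → u ∈ P → v ∈ P → u ≢ v → Dist≥ G 3 u v

  isPacking? : U.Decidable IsPacking
  isPacking? P = Fin.all? λ u → Fin.all? λ v →
    (u ∈? P) →-dec ((v ∈? P) →-dec (¬? (u Fin.≟ v) →-dec dist≥? G 3 u v))

  -- The empty set is a packing, so the base value 0 does not affect the
  -- maximum.
  ρ : ℕ
  ρ = max 0 (map ∣_∣ (filter isPacking? (subsets n)))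

  HYnumerator : ℤ
  HYnumerator = + Δ G ℤ.* (+ Δ G ℤ.- + 1) ℤ.* + ∣V∣ G ℤ.+ + (2 * ∣E∣ G)

  B-HY : ℚ
  B-HY = HYnumerator ℚ./ (1 + Δ G ^ 2)

  μ : ℤ
  μ = HYnumerator ℤ.- + (1 + Δ G ^ 2) ℤ.* + τD

------------------------------------------------------------------------
-- Loaded trees of fibres

-- An incidence (i , e) is given by i and the other end j of e.  The
-- adjacency proof is irrelevant, so the port depends only on (i , e).
Ports : ∀ {k} → Graph k → ℕ → Set
Ports {k} T q = ∀ (i j : Fin k) → .(Graph.Adj T i j) → Fin q

module _ {k q : ℕ} (T : Graph k) (R : Graph q) (p : Ports T q) where
  private
    module T = Graph T
    module R = Graph R

  PortAt : Fin k → Fin k → Fin q → Set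
  PortAt i j v = Σ (T.Adj i j) λ t → p i j t ≡ v

  portAt? : ∀ i j v → Dec (PortAt i j v)
  portAt? i j v with T.adj? i j
  ... | no ¬t = no λ (t , _) → ¬t t
  ... | yes t with p i j t Fin.≟ v
  ...   | yes eq = yes (t , eq)
  ...   | no ¬eq = no λ (_ , eq) → ¬eq eq

  -- Since T is simple, the edges at i correspond to the neighbours j of i.
  load : Fin k → Fin q → ℕ
  load i v = length (filter (λ j → portAt? i j v) (allFin k))

  maxLoad : ℕ
  maxLoad = max 0 (map (uncurry load) (cartesianProduct (allFin k) (allFin q)))

  IsUnusedSelector : Fin k → Fin q → Set
  IsUnusedSelector i s = load i s ≡ 0

  -- The vertex (i , a) is the vertex a of the copy Rᵢ.
  FibreAdj : Rel (Fin k × Fin q) 0ℓ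
  FibreAdj (i , a) (j , b) =
    (i ≡ j × R.Adj a b) ⊎ (PortAt i j a × PortAt j i b)

  private
    fibreAdj? : Decidable FibreAdj
    fibreAdj? (i , a) (j , b) =
      ((i Fin.≟ j) ×-dec R.adj? a b) ⊎-dec (portAt? i j a ×-dec portAt? j i b)

    fibre-sym : Symmetric FibreAdj
    fibre-sym (inj₁ (eq , r)) = inj₁ (sym eq , R.adj-sym r)
    fibre-sym (inj₂ (s , t))  = inj₂ (t , s)

    fibre-irrefl : ∀ {x} → ¬ FibreAdj x x
    fibre-irrefl (inj₁ (_ , r))       = R.adj-irrefl r
    fibre-irrefl (inj₂ ((t , _) , _)) = T.adj-irrefl t

  -- remQuot q : Fin (k * q) → Fin k × Fin q is a bijection.
  loadedTree : Graph (k * q)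
  loadedTree = record
    { Adj        = FibreAdj on remQuot q
    ; adj?       = λ u v → fibreAdj? (remQuot q u) (remQuot q v)
    ; adj-sym    = fibre-sym
    ; adj-irrefl = fibre-irrefl
    }

module Submission where

-- Complements of identifying vertex covers are exactly packings: two uncovered
-- vertices that are adjacent leave an edge with empty trace, and two uncovered
-- neighbours of a common vertex give two edges with the same trace.  Hence
-- τ_D(G) = n − ρ(G).  Each fibre has diameter at most two, so a packing meets
-- it at most once, while the unused selectors form a packing because all their
-- neighbours lie in their own fibres; thus ρ(G) = k.  Vertex v of R_i has degree
-- r + λ_i(v), and the handshake lemma turns |E(T)| = k − 1 into |E(G)|; the
-- former holds because in a connected acyclic graph every edge joins a vertex to
-- its parent with respect to a fixed root.

open import Defs
open import Data.Bool.Base using (true; false; if_then_else_)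
open import Data.Fin using (Fin; zero; suc; inject₁; fromℕ; combine; remQuot; _↑ˡ_; _↑ʳ_)
import Data.Fin as Fin
import Data.Fin.Properties as Fin
open import Data.Fin.Subset using (Subset; inside; outside; ∁; _∪_; _∩_; ⁅_⁆; ∣_∣; Nonempty)
  renaming (_∈_ to _∈ₛ_; _∉_ to _∉ₛ_)
open import Data.Fin.Subset.Properties
  using (∣∁p∣≡n∸∣p∣; _∈?_; x∈⁅x⁆; x∈⁅y⁆⇒x≡y; x∈p∪q⁺; x∈p∪q⁻; x∈p∩q⁺; x∈p∩q⁻;
         x∈∁p⇒x∉p; x∉p⇒x∈∁p; ⊆-antisym; ∪-comm)
open import Data.Integer as ℤ using (+_)
import Data.Integer.Properties as ℤ
open import Data.Integer.Tactic.RingSolver using (solve-∀)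
open import Data.List
  using (List; []; _∷_; map; _++_; filter; length; tabulate; allFin; cartesianProduct; lookup)
open import Data.List.Extrema.Nat using (argmax-sel; xs≤max; min≈v⁺; max≈v⁺)
open import Data.List.Membership.Propositional using (_∈_)
open import Data.List.Membership.Propositional.Properties
  using (∈-lookup; ∈-++⁺ˡ; ∈-++⁺ʳ; ∈-map⁺; ∈-map⁻; ∈-filter⁺; ∈-filter⁻; ∈-allFin; ∈-cartesianProduct⁺)
import Data.List.Membership.DecPropositional as DecMembership
open import Data.List.Properties using (map-tabulate; filter-++; length-++)
open import Data.List.Relation.Unary.All as All using (All; []; _∷_)
open import Data.List.Relation.Unary.All.Properties using (¬Any⇒All¬; map⁺)
open import Data.List.Relation.Unary.AllPairs using ([]; _∷_)
open import Data.List.Relation.Unary.Any using (here; there)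
open import Data.List.Relation.Unary.Unique.Propositional using (Unique)
import Data.List.Relation.Unary.Unique.Propositional.Properties as Unique
open import Data.Nat using (ℕ; zero; suc; _+_; _*_; _∸_; _^_; _≤_; _<_; z≤n; s≤s)
open import Data.Nat.Induction using (Acc; acc; <-wellFounded)
open import Data.Nat.Properties
open import Data.Product using (∃-syntax; _×_; _,_; proj₁; proj₂; uncurry)
open import Data.Rational as ℚ using (fromℚᵘ)
import Data.Rational.Properties as ℚ
open import Data.Rational.Unnormalised as ℚᵘ using (mkℚᵘ; *≡*)
import Data.Rational.Unnormalised.Properties as ℚᵘ
open import Data.Sum using (_⊎_; inj₁; inj₂; [_,_]′)
open import Data.Vec.Base as Vec using ([]; _∷_)
open import Data.Vec.Properties using (lookup∘tabulate; []=⇒lookup; lookup⇒[]=)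
open import Function using (_∘_; id)
open import Level using (0ℓ)
open import Relation.Binary using (Rel; Decidable; tri<; tri≈; tri>)
open import Relation.Binary.Construct.Closure.ReflexiveTransitive as Star using (Star; ε; _◅_; _◅◅_)
open import Relation.Binary.Construct.Closure.Symmetric using (SymClosure; fwd; bwd)
open import Relation.Binary.PropositionalEquality
open import Relation.Nullary using (¬_; Dec; does; yes; no; contradiction)
open import Relation.Nullary.Decidable using (_×-dec_; ¬?; dec-true)
import Relation.Unary as U

open import Algebra.Properties.Semiring.Sum +-*-semiring
  using (sum-syntax; sum-cong-≗; ∑-distrib-+; ∑-comm; *-distribˡ-sum)

open ≡-Reasoning

private
  variable
    A B C : Set
    k n q : ℕ

-- Counting by sums of indicators

-- Sums of these indicators replace lengths of filtered lists, so that double counting becomes an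
-- exchange of sums.
⟦_⟧ : Dec A → ℕ
⟦ A? ⟧ = if does A? then 1 else 0

⟦⟧-true : (A? : Dec A) → A → ⟦ A? ⟧ ≡ 1
⟦⟧-true (yes _) _ = refl
⟦⟧-true (no ¬a) a = contradiction a ¬a

⟦⟧-false : (A? : Dec A) → ¬ A → ⟦ A? ⟧ ≡ 0
⟦⟧-false (yes a) ¬a = contradiction a ¬a
⟦⟧-false (no _)  _  = refl

⟦⟧-cong : (A? : Dec A) (B? : Dec B) → (A → B) → (B → A) → ⟦ A? ⟧ ≡ ⟦ B? ⟧
⟦⟧-cong (yes a) B? f g = sym (⟦⟧-true B? (f a))
⟦⟧-cong (no ¬a) B? f g = sym (⟦⟧-false B? (¬a ∘ g))

⟦⟧-⊎ : (C? : Dec C) (A? : Dec A) (B? : Dec B) →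
       (C → A ⊎ B) → (A ⊎ B → C) → ¬ (A × B) → ⟦ C? ⟧ ≡ ⟦ A? ⟧ + ⟦ B? ⟧
⟦⟧-⊎ C? (yes a) (yes b) f g ¬ab = contradiction (a , b) ¬ab
⟦⟧-⊎ C? (yes a) (no _)  f g ¬ab = ⟦⟧-true C? (g (inj₁ a))
⟦⟧-⊎ C? (no _)  (yes b) f g ¬ab = ⟦⟧-true C? (g (inj₂ b))
⟦⟧-⊎ C? (no ¬a) (no ¬b) f g ¬ab = ⟦⟧-false C? ([ ¬a , ¬b ]′ ∘ f)

⟦⟧-× : (C? : Dec C) (A? : Dec A) (B? : Dec B) →
       (C → A × B) → (A × B → C) → ⟦ C? ⟧ ≡ ⟦ A? ⟧ * ⟦ B? ⟧
⟦⟧-× C? (yes a) (yes b) f g = ⟦⟧-true C? (g (a , b))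
⟦⟧-× C? (yes a) (no ¬b) f g = ⟦⟧-false C? (¬b ∘ proj₂ ∘ f)
⟦⟧-× C? (no ¬a) B?      f g = ⟦⟧-false C? (¬a ∘ proj₁ ∘ f)

∑-const : ∀ n c → ∑[ i < n ] c ≡ n * c
∑-const zero    c = refl
∑-const (suc n) c = cong (_+_ c) (∑-const n c)

∑-mono-≤ : {f g : Fin n → ℕ} → (∀ i → f i ≤ g i) → ∑[ i < n ] f i ≤ ∑[ i < n ] g i
∑-mono-≤ {zero}  f≤g = z≤n
∑-mono-≤ {suc n} f≤g = +-mono-≤ (f≤g zero) (∑-mono-≤ (f≤g ∘ suc))

∑-zero : {f : Fin n → ℕ} → (∀ i → f i ≡ 0) → ∑[ i < n ] f i ≡ 0
∑-zero {n} f≡0 = trans (sum-cong-≗ f≡0) (trans (∑-const n 0) (*-zeroʳ n))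

∑-single : {f : Fin n → ℕ} (x : Fin n) → (∀ i → i ≢ x → f i ≡ 0) → ∑[ i < n ] f i ≡ f x
∑-single {suc n} {f} zero f≡0 =
  trans (cong (_+_ (f zero)) (∑-zero (λ i → f≡0 (suc i) λ ()))) (+-identityʳ _)
∑-single {suc n} {f} (suc x) f≡0 =
  cong₂ _+_ (f≡0 zero λ ()) (∑-single x λ i i≢x → f≡0 (suc i) (i≢x ∘ Fin.suc-injective))

∑-++ : ∀ m n (f : Fin (m + n) → ℕ) →
       ∑[ i < m + n ] f i ≡ ∑[ i < m ] f (i ↑ˡ n) + ∑[ j < n ] f (m ↑ʳ j)
∑-++ zero    n f = refl
∑-++ (suc m) n f =
  trans (cong (_+_ (f zero)) (∑-++ m n (f ∘ suc))) (sym (+-assoc (f zero) _ _))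

-- `combine` numbers the pairs block by block: the first `q` indices form fibre `zero`, and shifting
-- by `q` leaves the same situation for the other fibres.
∑-combine : ∀ k q (f : Fin (k * q) → ℕ) →
            ∑[ x < k * q ] f x ≡ ∑[ i < k ] ∑[ a < q ] f (combine i a)
∑-combine zero    q f = refl
∑-combine (suc k) q f =
  trans (∑-++ q (k * q) f) (cong (_+_ _) (∑-combine k q (f ∘ (q ↑ʳ_))))

count≡1 : {P : Fin n → Set} (P? : U.Decidable P) {x : Fin n} →
          P x → (∀ {y} → P y → y ≡ x) → ∑[ i < n ] ⟦ P? i ⟧ ≡ 1
count≡1 P? {x} px unique =
  trans (∑-single x λ i i≢x → ⟦⟧-false (P? i) (i≢x ∘ unique)) (⟦⟧-true (P? x) px)

count≤1 : {P : Fin n → Set} (P? : U.Decidable P) →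
          (∀ {x y} → P x → P y → x ≡ y) → ∑[ i < n ] ⟦ P? i ⟧ ≤ 1
count≤1 P? unique with Fin.any? P?
... | yes (x , px) = ≤-reflexive (count≡1 P? px λ py → unique py px)
... | no  ¬p       = ≤-trans (≤-reflexive (∑-zero λ i → ⟦⟧-false (P? i) (¬p ∘ (i ,_)))) z≤n

length-filter-tabulate : {P : A → Set} (P? : U.Decidable P) (f : Fin n → A) →
                         length (filter P? (tabulate f)) ≡ ∑[ i < n ] ⟦ P? (f i) ⟧
length-filter-tabulate {n = zero}  P? f = refl
length-filter-tabulate {n = suc n} P? f with P? (f zero)
... | yes _ = cong suc (length-filter-tabulate P? (f ∘ suc))
... | no  _ = length-filter-tabulate P? (f ∘ suc)

length-filter-cartesianProduct :
  {P : A × B → Set} (P? : U.Decidable P) (f : Fin k → A) (g : Fin n → B) →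
  length (filter P? (cartesianProduct (tabulate f) (tabulate g)))
    ≡ ∑[ i < k ] ∑[ j < n ] ⟦ P? (f i , g j) ⟧
length-filter-cartesianProduct {k = zero}  P? f g = refl
length-filter-cartesianProduct {k = suc k} P? f g = begin
  length (filter P? (map (f zero ,_) (tabulate g) ++ rest))
    ≡⟨ cong length (filter-++ P? (map (f zero ,_) (tabulate g)) rest) ⟩
  length (filter P? (map (f zero ,_) (tabulate g)) ++ filter P? rest)
    ≡⟨ length-++ (filter P? (map (f zero ,_) (tabulate g))) ⟩
  length (filter P? (map (f zero ,_) (tabulate g))) + length (filter P? rest)
    ≡⟨ cong₂ _+_
         (trans (cong (length ∘ filter P?) (map-tabulate g (f zero ,_)))
                (length-filter-tabulate P? ((f zero ,_) ∘ g)))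
         (length-filter-cartesianProduct P? (f ∘ suc) g) ⟩
  _ ∎
  where rest = cartesianProduct (tabulate (f ∘ suc)) (tabulate g)

-- Degrees and the handshake lemma.

module _ (G : Graph n) where
  open Graph G

  degree≡∑ : ∀ v → degree G v ≡ ∑[ w < n ] ⟦ adj? v w ⟧
  degree≡∑ v = length-filter-tabulate (adj? v) id

  -- Edges are listed with the smaller end first, so the count added to its transpose covers every
  -- ordered adjacent pair exactly once.
  handshake : 2 * ∣E∣ G ≡ ∑[ v < n ] degree G v
  handshake = begin
    2 * ∣E∣ G
      ≡⟨ cong (_+_ (∣E∣ G)) (+-identityʳ (∣E∣ G)) ⟩
    ∣E∣ G + ∣E∣ G
      ≡⟨ cong₂ _+_ ∣E∣≡∑ (trans ∣E∣≡∑ (∑-comm below)) ⟩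
    ∑[ u < n ] ∑[ v < n ] below u v + ∑[ u < n ] ∑[ v < n ] below v u
      ≡⟨ ∑-distrib-+ (λ u → ∑[ v < n ] below u v) (λ u → ∑[ v < n ] below v u) ⟨
    ∑[ u < n ] (∑[ v < n ] below u v + ∑[ v < n ] below v u)
      ≡⟨ sum-cong-≗ (λ u → trans (sym (∑-distrib-+ (below u) (λ v → below v u))) (sum-cong-≗ (either-order u))) ⟩
    ∑[ u < n ] ∑[ v < n ] ⟦ adj? u v ⟧
      ≡⟨ sum-cong-≗ degree≡∑ ⟨
    ∑[ u < n ] degree G u ∎
    where
    below? : ∀ u v → Dec (u Fin.< v × Adj u v)
    below? u v = (u Fin.<? v) ×-dec adj? u v

    below : Fin n → Fin n → ℕ
    below u v = ⟦ below? u v ⟧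

    ∣E∣≡∑ : ∣E∣ G ≡ ∑[ u < n ] ∑[ v < n ] below u v
    ∣E∣≡∑ = length-filter-cartesianProduct (λ (u , v) → below? u v) id id

    order : ∀ {u v} → Adj u v → (u Fin.< v × Adj u v) ⊎ (v Fin.< u × Adj v u)
    order {u} {v} a with Fin.<-cmp u v
    ... | tri< u<v _ _  = inj₁ (u<v , a)
    ... | tri≈ _ refl _ = contradiction a adj-irrefl
    ... | tri> _ _ v<u  = inj₂ (v<u , adj-sym a)

    either-order : ∀ u v → below u v + below v u ≡ ⟦ adj? u v ⟧
    either-order u v = sym (⟦⟧-⊎ (adj? u v) (below? u v) (below? v u) order
      [ proj₂ , adj-sym ∘ proj₂ ]′ (λ (l , g) → <-asym (proj₁ l) (proj₁ g)))

-- The number of edges of a tree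

least : {P : ℕ → Set} → U.Decidable P → ∀ {n} → P n → ∃[ m ] (P m × (∀ {j} → P j → m ≤ j))
least P? {zero} p = zero , p , λ _ → z≤n
least {P} P? {suc n} p with P? 0
... | yes p₀ = zero , p₀ , λ _ → z≤n
... | no ¬p₀ with m , pm , m≤ ← least (P? ∘ suc) p = suc m , pm , bound
  where
  bound : ∀ {j} → P j → suc m ≤ j
  bound {zero}  p₀ = contradiction p₀ ¬p₀
  bound {suc j} p  = s≤s (m≤ p)

lookup-injective : {xs : List A} → Unique xs → ∀ {i j} → lookup xs i ≡ lookup xs j → i ≡ j
lookup-injective (x∉ ∷ u) {zero}  {zero}  eq = refl
lookup-injective (x∉ ∷ u) {zero}  {suc j} eq = contradiction eq (All.lookup x∉ (∈-lookup j))
lookup-injective (x∉ ∷ u) {suc i} {zero}  eq = contradiction (sym eq) (All.lookup x∉ (∈-lookup i))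
lookup-injective (x∉ ∷ u) {suc i} {suc j} eq = cong suc (lookup-injective u eq)

-- Simple paths and loop erasure.

module _ {R : Rel A 0ℓ} where

  infixr 5 _∷_

  -- The list index records all vertices in order, both ends included, so that simplicity is just
  -- `Unique` of that list.
  data Path : A → A → List A → Set where
    [-] : ∀ {u} → Path u u (u ∷ [])
    _∷_ : ∀ {u v w vs} → R u v → Path v w vs → Path u w (u ∷ vs)

  -- Shaped like the consecutive-adjacency condition of `IsCycle`, since `lookup xs i` is entry
  -- `suc i` of `x ∷ xs`.
  path-step : ∀ {u w x xs} → Path u w (x ∷ xs) →
              ∀ i → R (lookup (x ∷ xs) (inject₁ i)) (lookup xs i)
  path-step (r ∷ [-])      zero    = r
  path-step (r ∷ _ ∷ _)    zero    = r
  path-step (_ ∷ [-])      (suc ())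
  path-step (_ ∷ p@(_ ∷ _)) (suc i) = path-step p i

  path-last : ∀ {u w x xs} → Path u w (x ∷ xs) → lookup (x ∷ xs) (fromℕ (length xs)) ≡ w
  path-last [-]             = refl
  path-last (_ ∷ [-])       = refl
  path-last (_ ∷ p@(_ ∷ _)) = path-last p

  SimplePath : A → A → Set
  SimplePath u w = ∃[ vs ] (Path u w vs × Unique vs)

  simple-suffix : ∀ {u v w vs} → u ∈ vs → Path v w vs → Unique vs → SimplePath u w
  simple-suffix (here refl)     p@[-]     u       = _ , p , u
  simple-suffix (here refl)     p@(_ ∷ _) u       = _ , p , u
  simple-suffix (there u∈)      (_ ∷ p)   (_ ∷ u) = simple-suffix u∈ p u

  -- Erase loops in the tail first; if the starting vertex already occurs there, keep only the part
  -- from that occurrence on.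
  loop-erasure : Decidable (_≡_ {A = A}) → ∀ {u w} → Star R u w → SimplePath u w
  loop-erasure _≟_ ε = _ , [-] , [] ∷ []
  loop-erasure _≟_ {u} (r ◅ rs) with vs , p , uniq ← loop-erasure _≟_ rs | DecMembership._∈?_ _≟_ u vs
  ... | yes u∈ = simple-suffix u∈ p uniq
  ... | no u∉  = u ∷ vs , r ∷ p , ¬Any⇒All¬ vs u∉ ∷ uniq

module _ (G : Graph n) where
  open Graph G

  -- If R omitted the edge uw, the loop-erased walk would close up with it to a cycle.
  closing-edge : {R : Rel (Fin n) 0ℓ} → (∀ {u v} → R u v → Adj u v) → Acyclic G →
                 ∀ {u w} → Star R u w → Adj u w → ¬ ¬ R u w
  closing-edge {R} R⊆Adj acyclic {u} {w} walk adj ¬r with loop-erasure Fin._≟_ walk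
  ... | _ , [-] , _ = adj-irrefl adj
  ... | _ , r ∷ [-] , _ = ¬r r
  -- A one-vertex path made `adj` a loop and a two-vertex path was the excluded `R`-step; what
  -- remains is long enough for a cycle.
  ... | x ∷ y ∷ z ∷ vs , p@(_ ∷ _ ∷ _) , uniq = acyclic (length vs) (lookup (x ∷ y ∷ z ∷ vs))
    ( lookup-injective uniq
    , (λ i → R⊆Adj (path-step p i))
    , adj-sym (subst (Adj x) (sym (path-last p)) adj))

  -- Parents in a rooted tree.

  module _ (connected : Connected G) (acyclic : Acyclic G) (root : Fin n) where
    private
      nearest : ∀ v → ∃[ l ] (Walk G l v root × (∀ {j} → Walk G j v root → l ≤ j))
      nearest v = least (λ l → walk? G l v root) (proj₂ (proj₂ connected v root))

      depth : Fin n → ℕ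
      depth v = proj₁ (nearest v)

      -- Take the first step of a shortest walk to the root; the rest of that walk bounds the depth
      -- of `w`.
      find-parent : ∀ v → v ≢ root → ∃[ w ] (Adj v w × depth w < depth v)
      find-parent v v≢root with nearest v
      ... | zero  , v≡root , _ = contradiction v≡root v≢root
      ... | suc l , (w , a , walk) , _ = w , a , s≤s (proj₂ (proj₂ (nearest w)) walk)

      -- The value at the root is a placeholder, which `ChildOf` excludes.
      parent : Fin n → Fin n
      parent v with v Fin.≟ root
      ... | yes _     = root
      ... | no v≢root = proj₁ (find-parent v v≢root)

      parent-spec : ∀ v → v ≢ root → Adj v (parent v) × depth (parent v) < depth v
      parent-spec v v≢root with v Fin.≟ root
      ... | yes v≡root = contradiction v≡root v≢root
      ... | no v≢root′ = proj₂ (find-parent v v≢root′)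

      ChildOf : Rel (Fin n) 0ℓ
      ChildOf v w = v ≢ root × parent v ≡ w

      childOf? : Decidable ChildOf
      childOf? v w = ¬? (v Fin.≟ root) ×-dec (parent v Fin.≟ w)

      childOf⇒adj : ∀ {v w} → ChildOf v w → Adj v w
      childOf⇒adj (v≢root , refl) = proj₁ (parent-spec _ v≢root)

      to-root : ∀ v → Acc _<_ (depth v) → Star ChildOf v root
      to-root v (acc rec) with v Fin.≟ root
      ... | yes refl  = ε
      ... | no v≢root = (v≢root , refl) ◅ to-root (parent v) (rec (proj₂ (parent-spec v v≢root)))

      parent-walk : ∀ u v → Star (SymClosure ChildOf) u v
      parent-walk u v =
        Star.map fwd (to-root u (<-wellFounded _)) ◅◅
        Star.reverse id (Star.map bwd (to-root v (<-wellFounded _)))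

      -- Parent edges already connect all vertices, so by `closing-edge` any further edge would
      -- create a cycle. Decidability of `ChildOf` disposes of the double negation.
      adj⇒childOf : ∀ {u v} → Adj u v → ChildOf u v ⊎ ChildOf v u
      adj⇒childOf {u} {v} a with childOf? u v | childOf? v u
      ... | yes c | _     = inj₁ c
      ... | no _  | yes c = inj₂ c
      ... | no ¬c | no ¬c′ = contradiction
        (λ { (fwd c) → ¬c c ; (bwd c) → ¬c′ c })
        (closing-edge (λ { (fwd c) → childOf⇒adj c ; (bwd c) → adj-sym (childOf⇒adj c) })
          acyclic (parent-walk u v) a)

      -- Depth strictly decreases from child to parent.
      childOf-asym : ∀ {u v} → ¬ (ChildOf u v × ChildOf v u)
      childOf-asym {u} ((u≢ , refl) , (v≢ , eq)) = <-asym (proj₂ (parent-spec _ u≢))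
        (subst (λ x → depth x < depth (parent u)) eq (proj₂ (parent-spec _ v≢)))

      c : Fin n → Fin n → ℕ
      c u v = ⟦ childOf? u v ⟧

      -- The root lacks a parent and every other vertex has exactly one. The decision is an argument
      -- so that splitting on it evaluates the indicator.
      ∑-parents : ∀ v (v≟root : Dec (v ≡ root)) → ∑[ w < n ] c v w + ⟦ v≟root ⟧ ≡ 1
      ∑-parents v (yes v≡root) =
        cong (_+ 1) (∑-zero λ w → ⟦⟧-false (childOf? v w) λ (v≢root , _) → v≢root v≡root)
      ∑-parents v (no v≢root)  =
        trans (+-identityʳ _) (count≡1 (childOf? v) (v≢root , refl) (sym ∘ proj₂))

      ∑-childOf : ∑[ v < n ] ∑[ w < n ] c v w + 1 ≡ n
      ∑-childOf = begin
        ∑[ v < n ] ∑[ w < n ] c v w + 1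
          ≡⟨ cong (_+_ _) (count≡1 (Fin._≟ root) refl id) ⟨
        ∑[ v < n ] ∑[ w < n ] c v w + ∑[ v < n ] ⟦ v Fin.≟ root ⟧
          ≡⟨ ∑-distrib-+ (λ v → ∑[ w < n ] c v w) (λ v → ⟦ v Fin.≟ root ⟧) ⟨
        ∑[ v < n ] (∑[ w < n ] c v w + ⟦ v Fin.≟ root ⟧)
          ≡⟨ sum-cong-≗ (λ v → ∑-parents v (v Fin.≟ root)) ⟩
        ∑[ v < n ] 1
          ≡⟨ trans (∑-const n 1) (*-identityʳ n) ⟩
        n ∎

    -- The degree of `v` is its number of parents plus its number of children, so the degree sum
    -- counts each parent-child pair twice.
    rooted-tree-∣E∣ : ∣E∣ G + 1 ≡ n
    rooted-tree-∣E∣ = trans (cong (_+ 1) (*-cancelˡ-≡ _ _ 2 (begin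
      2 * ∣E∣ G
        ≡⟨ handshake G ⟩
      ∑[ v < n ] degree G v
        ≡⟨ sum-cong-≗ (λ v → trans (degree≡∑ G v) (trans (sum-cong-≗ (split v)) (∑-distrib-+ (c v) (λ w → c w v)))) ⟩
      ∑[ v < n ] (∑[ w < n ] c v w + ∑[ w < n ] c w v)
        ≡⟨ ∑-distrib-+ (λ v → ∑[ w < n ] c v w) (λ v → ∑[ w < n ] c w v) ⟩
      ∑[ v < n ] ∑[ w < n ] c v w + ∑[ v < n ] ∑[ w < n ] c w v
        ≡⟨ cong (_+_ _) (trans (∑-comm (λ v w → c w v)) (sym (+-identityʳ _))) ⟩
      2 * (∑[ v < n ] ∑[ w < n ] c v w) ∎))) ∑-childOf
      where
      split : ∀ v w → ⟦ adj? v w ⟧ ≡ c v w + c w v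
      split v w = ⟦⟧-⊎ (adj? v w) (childOf? v w) (childOf? w v) adj⇒childOf
        [ childOf⇒adj , adj-sym ∘ childOf⇒adj ]′ childOf-asym

  tree-∣E∣ : IsTree G → ∣E∣ G + 1 ≡ n
  tree-∣E∣ ((n>0 , walks) , acyclic) = rooted-tree-∣E∣ (n>0 , walks) acyclic (Fin.fromℕ< n>0)

-- Identifying vertex covers and packings

∈-subsets : (S : Subset n) → S ∈ subsets n
∈-subsets [] = here refl
∈-subsets {suc n} (true  ∷ S) = ∈-++⁺ˡ (∈-map⁺ (inside ∷_) (∈-subsets S))
∈-subsets {suc n} (false ∷ S) = ∈-++⁺ʳ (map (inside ∷_) (subsets n)) (∈-map⁺ (outside ∷_) (∈-subsets S))

-- Injectivity is required only on members of the list: a trace cannot tell `(u , v)` from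
-- `(v , u)`, but only increasing pairs are listed.
map-unique⁺ : {f : A → B} {xs : List A} → (∀ {x y} → x ∈ xs → y ∈ xs → f x ≡ f y → x ≡ y) →
              Unique xs → Unique (map f xs)
map-unique⁺ inj []          = []
map-unique⁺ inj (x∉ ∷ uniq) =
  map⁺ (All.tabulate λ y∈ fx≡fy → All.lookup x∉ y∈ (inj (here refl) (there y∈) fx≡fy))
    ∷ map-unique⁺ (λ x∈ y∈ → inj (there x∈) (there y∈)) uniq

map-unique⁻ : {f : A → B} {xs : List A} → Unique (map f xs) →
              ∀ {x y} → x ∈ xs → y ∈ xs → f x ≡ f y → x ≡ y
map-unique⁻ (fx∉ ∷ uniq) (here refl) (here refl) eq = refl
map-unique⁻ {f = f} (fx∉ ∷ uniq) (here refl) (there y∈) eq = contradiction eq (All.lookup fx∉ (∈-map⁺ f y∈))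
map-unique⁻ {f = f} (fx∉ ∷ uniq) (there x∈) (here refl) eq = contradiction (sym eq) (All.lookup fx∉ (∈-map⁺ f x∈))
map-unique⁻ (fx∉ ∷ uniq) (there x∈)  (there y∈)  eq = map-unique⁻ uniq x∈ y∈ eq

module _ (G : Graph n) where
  private module G = Graph G

  ∈-edges⁻ : ∀ {u v} → (u , v) ∈ edges G → u Fin.< v × G.Adj u v
  ∈-edges⁻ e∈ = proj₂ (∈-filter⁻ (λ (u , v) → (u Fin.<? v) ×-dec G.adj? u v)
    {xs = cartesianProduct (allFin n) (allFin n)} e∈)

  ∈-edges⁺ : ∀ {u v} → u Fin.< v → G.Adj u v → (u , v) ∈ edges G
  ∈-edges⁺ u<v a = ∈-filter⁺ (λ (u , v) → (u Fin.<? v) ×-dec G.adj? u v)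
    (∈-cartesianProduct⁺ (∈-allFin _) (∈-allFin _)) (u<v , a)

  edges-unique : Unique (edges G)
  edges-unique = Unique.filter⁺ _ (Unique.cartesianProduct⁺ (Unique.allFin⁺ n) (Unique.allFin⁺ n))

  ∈-trace⁺ˡ : ∀ S {u v} → u ∈ₛ S → u ∈ₛ trace G S (u , v)
  ∈-trace⁺ˡ S {u} u∈S = x∈p∩q⁺ (x∈p∪q⁺ (inj₁ (x∈⁅x⁆ u)) , u∈S)

  ∈-trace⁺ʳ : ∀ S {u v} → v ∈ₛ S → v ∈ₛ trace G S (u , v)
  ∈-trace⁺ʳ S {u} {v} v∈S = x∈p∩q⁺ (x∈p∪q⁺ {p = ⁅ u ⁆} (inj₂ (x∈⁅x⁆ v)) , v∈S)

  ∈-trace⁻ : ∀ S {u v x} → x ∈ₛ trace G S (u , v) → (x ≡ u ⊎ x ≡ v) × x ∈ₛ S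
  ∈-trace⁻ S {u} {v} x∈ with x∈uv , x∈S ← x∈p∩q⁻ (⁅ u ⁆ ∪ ⁅ v ⁆) S x∈ | x∈p∪q⁻ ⁅ u ⁆ ⁅ v ⁆ x∈uv
  ... | inj₁ x∈u = inj₁ (x∈⁅y⁆⇒x≡y u x∈u) , x∈S
  ... | inj₂ x∈v = inj₂ (x∈⁅y⁆⇒x≡y v x∈v) , x∈S

  trace-comm : ∀ S u v → trace G S (u , v) ≡ trace G S (v , u)
  trace-comm S u v = cong (_∩ S) (∪-comm ⁅ u ⁆ ⁅ v ⁆)

  -- Finds the listed orientation of an adjacent pair; the last component allows its ends to be
  -- recovered.
  edge-between : ∀ {u v} → G.Adj u v →
    ∃[ e ] (e ∈ edges G × (∀ S → trace G S e ≡ trace G S (u , v)) × (e ≡ (u , v) ⊎ e ≡ (v , u)))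
  edge-between {u} {v} a with Fin.<-cmp u v
  ... | tri< u<v _ _  = (u , v) , ∈-edges⁺ u<v a , (λ S → refl) , inj₁ refl
  ... | tri≈ _ refl _ = contradiction a G.adj-irrefl
  ... | tri> _ _ v<u  = (v , u) , ∈-edges⁺ v<u (G.adj-sym a) , (λ S → trace-comm S v u) , inj₂ refl

  packing⇒IVC : ∀ P → IsPacking G P → IsIdentifyingVertexCover G (∁ P)
  packing⇒IVC P packing = All.tabulate covered , map-unique⁺ identified edges-unique
    where
    tr : Fin n → Fin n → Subset n
    tr u v = trace G (∁ P) (u , v)

    covered : ∀ {e} → e ∈ edges G → Nonempty (trace G (∁ P) e)
    covered {u , v} e∈ with u ∈? P | v ∈? P
    ... | no u∉P  | _       = u , ∈-trace⁺ˡ (∁ P) (x∉p⇒x∈∁p u∉P)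
    ... | yes _   | no v∉P  = v , ∈-trace⁺ʳ (∁ P) (x∉p⇒x∈∁p v∉P)
    ... | yes u∈P | yes v∈P with u<v , a ← ∈-edges⁻ e∈ =
      contradiction (v , a , refl) (packing u v u∈P v∈P (Fin.<⇒≢ u<v) (suc zero))

    other-end : ∀ {u v w} → u ≢ v → v ∉ₛ P → tr u v ≡ tr u w → v ≡ w
    other-end {u} {v} u≢v v∉P eq
      with ∈-trace⁻ (∁ P) (subst (v ∈ₛ_) eq (∈-trace⁺ʳ (∁ P) (x∉p⇒x∈∁p v∉P)))
    ... | inj₁ v≡u , _ = contradiction (sym v≡u) u≢v
    ... | inj₂ v≡w , _ = v≡w

    -- An end outside `P` shows up in the trace. If both other ends lie in `P` and differ, the
    -- common neighbour `u` puts them at distance at most two.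
    common-end : ∀ {u v w} → G.Adj u v → G.Adj u w → tr u v ≡ tr u w → v ≡ w
    common-end {u} {v} {w} a b eq with v ∈? P | w ∈? P | v Fin.≟ w
    ... | no v∉P  | _       | _       = other-end (λ { refl → G.adj-irrefl a }) v∉P eq
    ... | yes _   | no w∉P  | _       = sym (other-end (λ { refl → G.adj-irrefl b }) w∉P (sym eq))
    ... | yes _   | yes _   | yes v≡w = v≡w
    ... | yes v∈P | yes w∈P | no v≢w  = contradiction (u , G.adj-sym a , w , b , refl)
      (packing v w v∈P w∈P v≢w (suc (suc zero)))

    -- The end `u`, being in the cover, lies in the second trace and hence is `x` or `y`; the edges
    -- then share it and `common-end` applies.
    tr-injective : ∀ {u v x y} → G.Adj u v → G.Adj x y → u ∉ₛ P → tr u v ≡ tr x y →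
                   (u ≡ x × v ≡ y) ⊎ (u ≡ y × v ≡ x)
    tr-injective {u} {v} {x} {y} a b u∉P eq
      with ∈-trace⁻ (∁ P) (subst (u ∈ₛ_) eq (∈-trace⁺ˡ (∁ P) (x∉p⇒x∈∁p u∉P)))
    ... | inj₁ refl , _ = inj₁ (refl , common-end a b eq)
    ... | inj₂ refl , _ = inj₂ (refl , common-end a (G.adj-sym b) (trans eq (trace-comm (∁ P) x y)))

    identified : ∀ {e f} → e ∈ edges G → f ∈ edges G → trace G (∁ P) e ≡ trace G (∁ P) f → e ≡ f
    identified {u , v} {x , y} e∈ f∈ eq
      with u<v , a ← ∈-edges⁻ e∈ | x<y , b ← ∈-edges⁻ f∈ | z , z∈ ← covered e∈
      with ∈-trace⁻ (∁ P) z∈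
    ... | inj₁ refl , z∈∁P with tr-injective a b (x∈∁p⇒x∉p z∈∁P) eq
    ...   | inj₁ (refl , refl) = refl
    -- Both listed pairs are increasing, so the swapped alternative is impossible.
    ...   | inj₂ (refl , refl) = contradiction x<y (<-asym u<v)
    identified {u , v} {x , y} e∈ f∈ eq
        | inj₂ refl , z∈∁P with tr-injective (G.adj-sym a) b (x∈∁p⇒x∉p z∈∁P) (trans (trace-comm (∁ P) v u) eq)
    ...   | inj₁ (refl , refl) = contradiction x<y (<-asym u<v)
    ...   | inj₂ (refl , refl) = refl

  IVC⇒packing : ∀ S → IsIdentifyingVertexCover G S → IsPacking G (∁ S)
  IVC⇒packing S (cover , unique) u v u∈ v∈ u≢v = far
    where
    u∉S = x∈∁p⇒x∉p u∈
    v∉S = x∈∁p⇒x∉p v∈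

    trace-pendant : ∀ {x w y} → x ∉ₛ S → y ∈ₛ trace G S (x , w) → y ≡ w × y ∈ₛ S
    trace-pendant x∉S y∈ with ∈-trace⁻ S y∈
    ... | inj₁ refl , y∈S = contradiction y∈S x∉S
    ... | inj₂ y≡w  , y∈S = y≡w , y∈S

    -- With `x` uncovered the trace contains at most `w`, which remains an end when `x` is replaced.
    traces-⊆ : ∀ {x x′ w y} → x ∉ₛ S → y ∈ₛ trace G S (x , w) → y ∈ₛ trace G S (x′ , w)
    traces-⊆ x∉S y∈ with refl , y∈S ← trace-pendant x∉S y∈ = ∈-trace⁺ʳ S y∈S

    far : Dist≥ G 3 u v
    far zero u≡v = u≢v u≡v
    -- The nonempty trace of the edge `uv` could only contain `v`, which is uncovered.
    far (suc zero) (.v , a , refl)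
      with e , e∈ , tr , _ ← edge-between a
      with y , y∈ ← All.lookup cover e∈
      with refl , y∈S ← trace-pendant u∉S (subst (y ∈ₛ_) (tr S) y∈) = v∉S y∈S
    -- The edges `uw` and `vw` have the same trace, hence are equal; each choice of orientations
    -- yields `u ≡ v` or a loop.
    far (suc (suc zero)) (w , a , .v , b , refl)
      with e , e∈ , tr , e≡ ← edge-between a | f , f∈ , tr′ , f≡ ← edge-between (G.adj-sym b)
      with map-unique⁻ unique e∈ f∈ (trans (tr S) (trans (⊆-antisym (traces-⊆ u∉S) (traces-⊆ v∉S)) (sym (tr′ S))))
    ... | refl with e≡ | f≡
    ...   | inj₁ refl | inj₁ refl = u≢v refl
    ...   | inj₁ refl | inj₂ refl = G.adj-irrefl a
    ...   | inj₂ refl | inj₁ refl = G.adj-irrefl a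
    ...   | inj₂ refl | inj₂ refl = u≢v refl

  -- Maximum packings and minimum identifying vertex covers.

  module _ {m} (P : Subset n) (packing : IsPacking G P) (∣P∣≡m : ∣ P ∣ ≡ m)
           (maximum : ∀ Q → IsPacking G Q → ∣ Q ∣ ≤ m) where

    ρ-maximum : ρ G ≡ m
    ρ-maximum = max≈v⁺
      (subst (_∈ sizes) ∣P∣≡m (∈-map⁺ ∣_∣ (∈-filter⁺ (isPacking? G) (∈-subsets P) packing)))
      (map⁺ (All.tabulate λ Q∈ → maximum _ (proj₂ (∈-filter⁻ (isPacking? G) {xs = subsets n} Q∈))))
      z≤n
      where sizes = map ∣_∣ (filter (isPacking? G) (subsets n))

    τD-complement : τD G ≡ n ∸ m
    τD-complement = min≈v⁺
      (subst (_∈ sizes) (trans (∣∁p∣≡n∸∣p∣ P) (cong (n ∸_) ∣P∣≡m))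
        (∈-map⁺ ∣_∣ (∈-filter⁺ IVC? (∈-subsets (∁ P)) (packing⇒IVC P packing))))
      (map⁺ (All.tabulate λ {S} S∈ → bound S (proj₂ (∈-filter⁻ IVC? {xs = subsets n} S∈))))
      -- The base value `n` of the minimum does not undercut `n ∸ m`.
      (m∸n≤m n m)
      where
      IVC?  = isIdentifyingVertexCover? G
      sizes = map ∣_∣ (filter IVC? (subsets n))

      bound : ∀ S → IsIdentifyingVertexCover G S → n ∸ m ≤ ∣ S ∣
      bound S ivc = m≤n+o⇒m∸n≤o n m (≤-trans (m≤n+m∸n n ∣ S ∣) (≤-trans
        (+-monoʳ-≤ ∣ S ∣ (subst (_≤ m) (∣∁p∣≡n∸∣p∣ S) (maximum (∁ S) (IVC⇒packing S ivc))))
        (≤-reflexive (+-comm ∣ S ∣ m))))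

-- Loaded trees of fibres

∣∣≡∑ : (S : Subset n) → ∣ S ∣ ≡ ∑[ x < n ] ⟦ x ∈? S ⟧
∣∣≡∑ []          = refl
∣∣≡∑ {suc n} (true  ∷ S) = cong suc (∣∣≡∑ S)
∣∣≡∑ {suc n} (false ∷ S) = ∣∣≡∑ S

comprehension : {P : Fin n → Set} → U.Decidable P →
                ∃[ S ] (∀ x → (x ∈ₛ S → P x) × (P x → x ∈ₛ S))
comprehension {n} {P} P? = S , λ x → to x , from x
  where
  S : Subset n
  S = Vec.tabulate (does ∘ P?)

  to : ∀ x → x ∈ₛ S → P x
  to x x∈ with P? x | trans (sym (lookup∘tabulate (does ∘ P?) x)) ([]=⇒lookup x∈)
  ... | yes px | _ = px

  from : ∀ x → P x → x ∈ₛ S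
  from x px = lookup⇒[]= x S (trans (lookup∘tabulate (does ∘ P?) x) (dec-true (P? x) px))

module _ (G : Graph n) where
  private module G = Graph G

  -- `Star` forgets lengths and concatenates freely; connectedness is proved there and transferred
  -- back.
  walk⇒star : ∀ l {u v} → Walk G l u v → Star G.Adj u v
  walk⇒star zero    refl        = ε
  walk⇒star (suc l) (_ , a , w) = a ◅ walk⇒star l w

  star⇒walk : ∀ {u v} → Star G.Adj u v → ∃[ l ] Walk G l u v
  star⇒walk ε        = zero , refl
  star⇒walk (a ◅ as) with l , w ← star⇒walk as = suc l , _ , a , w

module _ (T : Graph k) (R : Graph q) (p : Ports T q) where
  private
    module T = Graph T
    module R = Graph R
    G = loadedTree T R p
    module G = Graph G
    Load = load T R p
    Port = PortAt T R p
    port? = portAt? T R p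

  -- Adjacency is defined through `remQuot`; this transport and its converse allow vertices to be
  -- written as `combine i a`.
  fibreAdj⇒adj : ∀ i a j b → FibreAdj T R p (i , a) (j , b) → G.Adj (combine i a) (combine j b)
  fibreAdj⇒adj i a j b =
    subst₂ (FibreAdj T R p) (sym (Fin.remQuot-combine i a)) (sym (Fin.remQuot-combine j b))

  adj⇒fibreAdj : ∀ i a j b → G.Adj (combine i a) (combine j b) → FibreAdj T R p (i , a) (j , b)
  adj⇒fibreAdj i a j b =
    subst₂ (FibreAdj T R p) (Fin.remQuot-combine i a) (Fin.remQuot-combine j b)

  load≡∑ : ∀ i a → Load i a ≡ ∑[ j < k ] ⟦ port? i j a ⟧
  load≡∑ i a = length-filter-tabulate (λ j → port? i j a) id

  -- Each incidence chooses exactly one port.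
  ∑-ports : ∀ i j → ∑[ a < q ] ⟦ port? i j a ⟧ ≡ ⟦ T.adj? i j ⟧
  ∑-ports i j = go (T.adj? i j)
    where
    go : (t? : Dec (T.Adj i j)) → ∑[ a < q ] ⟦ port? i j a ⟧ ≡ ⟦ t? ⟧
    go (yes t) = count≡1 (port? i j) (t , refl) (λ (_ , eq) → sym eq)
    go (no ¬t) = ∑-zero λ a → ⟦⟧-false (port? i j a) (¬t ∘ proj₁)

  ∑-load : ∀ i → ∑[ a < q ] Load i a ≡ degree T i
  ∑-load i = begin
    ∑[ a < q ] Load i a                    ≡⟨ sum-cong-≗ (load≡∑ i) ⟩
    ∑[ a < q ] ∑[ j < k ] ⟦ port? i j a ⟧  ≡⟨ ∑-comm (λ a j → ⟦ port? i j a ⟧) ⟩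
    ∑[ j < k ] ∑[ a < q ] ⟦ port? i j a ⟧  ≡⟨ sum-cong-≗ (∑-ports i) ⟩
    ∑[ j < k ] ⟦ T.adj? i j ⟧              ≡⟨ degree≡∑ T i ⟨
    degree T i                             ∎

  -- Besides its neighbours within the fibre, the vertex gains one neighbour for each incidence
  -- whose port it is, namely the port at the opposite end. The two kinds are disjoint because `T`
  -- has no loops.
  degree-combine : ∀ i a → degree G (combine i a) ≡ degree R a + Load i a
  degree-combine i a = begin
    degree G (combine i a)
      ≡⟨ degree≡∑ G (combine i a) ⟩
    ∑[ x < k * q ] ⟦ G.adj? (combine i a) x ⟧
      ≡⟨ ∑-combine k q (λ x → ⟦ G.adj? (combine i a) x ⟧) ⟩
    ∑[ j < k ] ∑[ b < q ] ⟦ G.adj? (combine i a) (combine j b) ⟧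
      ≡⟨ sum-cong-≗ (λ j → trans (sum-cong-≗ (split j))
           (∑-distrib-+ (λ b → ⟦ i Fin.≟ j ⟧ * ⟦ R.adj? a b ⟧) (λ b → ⟦ port? i j a ⟧ * ⟦ port? j i b ⟧))) ⟩
    ∑[ j < k ] (∑[ b < q ] (⟦ i Fin.≟ j ⟧ * ⟦ R.adj? a b ⟧) + ∑[ b < q ] (⟦ port? i j a ⟧ * ⟦ port? j i b ⟧))
      ≡⟨ sum-cong-≗ (λ j → cong₂ _+_
           (*-distribˡ-sum ⟦ i Fin.≟ j ⟧ (λ b → ⟦ R.adj? a b ⟧))
           (*-distribˡ-sum ⟦ port? i j a ⟧ (λ b → ⟦ port? j i b ⟧))) ⟨
    ∑[ j < k ] (⟦ i Fin.≟ j ⟧ * (∑[ b < q ] ⟦ R.adj? a b ⟧) + ⟦ port? i j a ⟧ * (∑[ b < q ] ⟦ port? j i b ⟧))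
      ≡⟨ sum-cong-≗ (λ j → cong₂ _+_ (cong (⟦ i Fin.≟ j ⟧ *_) (sym (degree≡∑ R a))) (far-port j (port? i j a))) ⟩
    ∑[ j < k ] (⟦ i Fin.≟ j ⟧ * degree R a + ⟦ port? i j a ⟧)
      ≡⟨ ∑-distrib-+ (λ j → ⟦ i Fin.≟ j ⟧ * degree R a) (λ j → ⟦ port? i j a ⟧) ⟩
    ∑[ j < k ] (⟦ i Fin.≟ j ⟧ * degree R a) + ∑[ j < k ] ⟦ port? i j a ⟧
      ≡⟨ cong₂ _+_
           (∑-single i λ j j≢i → cong (_* degree R a) (⟦⟧-false (i Fin.≟ j) (j≢i ∘ sym)))
           (sym (load≡∑ i a)) ⟩
    ⟦ i Fin.≟ i ⟧ * degree R a + Load i a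
      ≡⟨ cong (_+ Load i a) (trans (cong (_* degree R a) (⟦⟧-true (i Fin.≟ i) refl)) (*-identityˡ _)) ⟩
    degree R a + Load i a ∎
    where
    split : ∀ j b → ⟦ G.adj? (combine i a) (combine j b) ⟧
                  ≡ ⟦ i Fin.≟ j ⟧ * ⟦ R.adj? a b ⟧ + ⟦ port? i j a ⟧ * ⟦ port? j i b ⟧
    split j b = trans
      (⟦⟧-⊎ (G.adj? (combine i a) (combine j b)) (i Fin.≟ j ×-dec R.adj? a b) (port? i j a ×-dec port? j i b)
        (adj⇒fibreAdj i a j b) (fibreAdj⇒adj i a j b)
        (λ { ((refl , _) , ((t , _) , _)) → T.adj-irrefl t }))
      (cong₂ _+_ (⟦⟧-× (i Fin.≟ j ×-dec R.adj? a b) (i Fin.≟ j) (R.adj? a b) id id)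
                 (⟦⟧-× (port? i j a ×-dec port? j i b) (port? i j a) (port? j i b) id id))

    far-port : ∀ j (p? : Dec (Port i j a)) → ⟦ p? ⟧ * (∑[ b < q ] ⟦ port? j i b ⟧) ≡ ⟦ p? ⟧
    far-port j (no _)        = refl
    far-port j (yes (t , _)) =
      trans (*-identityˡ _) (trans (∑-ports j i) (⟦⟧-true (T.adj? j i) (T.adj-sym t)))

  Δ-loadedTree : ∀ {r} → Regular R r → 0 < k → 0 < q → Δ G ≡ r + maxLoad T R p
  Δ-loadedTree {r} regular k>0 q>0 = max≈v⁺ attained bounded z≤n
    where
    loads = map (uncurry Load) (cartesianProduct (allFin k) (allFin q))

    degree≡ : ∀ i a → degree G (combine i a) ≡ r + Load i a
    degree≡ i a = trans (degree-combine i a) (cong (_+ Load i a) (regular a))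

    load∈loads : ∀ i a → Load i a ∈ loads
    load∈loads i a = ∈-map⁺ (uncurry Load) (∈-cartesianProduct⁺ (∈-allFin i) (∈-allFin a))

    load≤ : ∀ i a → Load i a ≤ maxLoad T R p
    load≤ i a = All.lookup (xs≤max 0 loads) (load∈loads i a)

    heaviest : ∃[ i ] ∃[ a ] Load i a ≡ maxLoad T R p
    heaviest with argmax-sel id 0 loads
    -- If the maximum is the base value 0, all loads vanish and any vertex attains it; positivity of
    -- `k` and `q` supplies one.
    ... | inj₁ max≡0 = i , a , ≤-antisym (load≤ i a) (≤-trans (≤-reflexive max≡0) z≤n)
      where
      i = Fin.fromℕ< k>0
      a = Fin.fromℕ< q>0
    ... | inj₂ max∈
      with (i , a) , _ , eq ← ∈-map⁻ (uncurry Load) {xs = cartesianProduct (allFin k) (allFin q)} max∈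
      = i , a , sym eq

    attained : r + maxLoad T R p ∈ map (degree G) (allFin (k * q))
    attained with i , a , eq ← heaviest =
      subst (_∈ map (degree G) (allFin (k * q))) (trans (degree≡ i a) (cong (_+_ r) eq))
        (∈-map⁺ (degree G) (∈-allFin (combine i a)))

    bounded : All (_≤ r + maxLoad T R p) (map (degree G) (allFin (k * q)))
    bounded = map⁺ (All.tabulate λ {x} _ → bound x)
      where
      bound : ∀ x → degree G x ≤ r + maxLoad T R p
      bound x with i , a , refl ← Fin.combine-surjective {k} x =
        ≤-trans (≤-reflexive (degree≡ i a)) (+-monoʳ-≤ r (load≤ i a))

  -- Handshake in both graphs: the loads within a fibre add up to the degree of its index in `T`.
  -- Doubling avoids dividing `r * q * k`.
  ∣E∣-loadedTree : ∀ {r} → Regular R r → 2 * ∣E∣ G ≡ r * q * k + 2 * ∣E∣ T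
  ∣E∣-loadedTree {r} regular = begin
    2 * ∣E∣ G
      ≡⟨ handshake G ⟩
    ∑[ x < k * q ] degree G x
      ≡⟨ ∑-combine k q (degree G) ⟩
    ∑[ i < k ] ∑[ a < q ] degree G (combine i a)
      ≡⟨ sum-cong-≗ (λ i → sum-cong-≗ λ a → trans (degree-combine i a) (cong (_+ Load i a) (regular a))) ⟩
    ∑[ i < k ] ∑[ a < q ] (r + Load i a)
      ≡⟨ sum-cong-≗ (λ i → trans (∑-distrib-+ (λ _ → r) (Load i)) (cong₂ _+_ (∑-const q r) (∑-load i))) ⟩
    ∑[ i < k ] (q * r + degree T i)
      ≡⟨ ∑-distrib-+ (λ _ → q * r) (degree T) ⟩
    ∑[ i < k ] (q * r) + ∑[ i < k ] degree T i
      ≡⟨ cong₂ _+_ (∑-const k (q * r)) (sym (handshake T)) ⟩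
    k * (q * r) + 2 * ∣E∣ T
      ≡⟨ cong (_+ 2 * ∣E∣ T) (trans (*-comm k (q * r)) (cong (_* k) (*-comm q r))) ⟩
    r * q * k + 2 * ∣E∣ T ∎

  fibre-walk : ∀ (i : Fin k) l {a b} → Walk R l a b → Walk G l (combine i a) (combine i b)
  fibre-walk i zero    refl        = refl
  fibre-walk i (suc l) {a} (c , r , w) = combine i c , fibreAdj⇒adj i a i c (inj₁ (refl , r)) , fibre-walk i l w

  connected-loadedTree : Connected T → Connected R → Connected G
  connected-loadedTree (k>0 , T-walk) (q>0 , R-walk) = *-mono-≤ k>0 q>0 , G-walk
    where
    fibre : ∀ (i : Fin k) a b → Star G.Adj (combine i a) (combine i b)
    fibre i a b with l , w ← R-walk a b = walk⇒star G l (fibre-walk i l w)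

    -- For each tree edge, walk inside the fibre to its port, cross, and continue from the opposite
    -- port.
    across : ∀ {i j} → Star T.Adj i j → ∀ a b → Star G.Adj (combine i a) (combine j b)
    across ε        a b = fibre _ a b
    across (_◅_ {i} {i′} t ts) a b =
      fibre i a (p i i′ t) ◅◅
      fibreAdj⇒adj i (p i i′ t) i′ (p i′ i (T.adj-sym t)) (inj₂ ((t , refl) , (T.adj-sym t , refl))) ◅
      across ts (p i′ i (T.adj-sym t)) b

    G-walk : ∀ x y → ∃[ l ] Walk G l x y
    G-walk x y
      with i , a , refl ← Fin.combine-surjective {k} x | j , b , refl ← Fin.combine-surjective {k} y
      with l , w ← T-walk i j = star⇒walk G (across (walk⇒star T l w) a b)

  -- Packings in a loaded tree.

  packing-bound : Diameter≤ R 2 → ∀ Q → IsPacking G Q → ∣ Q ∣ ≤ k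
  packing-bound diam Q packing = ≤-trans
    (≤-reflexive (trans (∣∣≡∑ Q) (∑-combine k q (λ x → ⟦ x ∈? Q ⟧))))
    (≤-trans (∑-mono-≤ λ i → count≤1 (λ a → combine i a ∈? Q) (one-per-fibre i))
             (≤-reflexive (trans (∑-const k 1) (*-identityʳ k))))
    where
    one-per-fibre : ∀ (i : Fin k) {a b} → combine i a ∈ₛ Q → combine i b ∈ₛ Q → a ≡ b
    one-per-fibre i {a} {b} a∈ b∈ with a Fin.≟ b
    ... | yes a≡b = a≡b
    ... | no a≢b with l , l≤2 , w ← diam a b =
      -- `Dist≥ G 3` takes lengths in `Fin 3`, so `l ≤ 2` is turned into such an index and the walk
      -- is transported accordingly.
      contradiction (subst (λ l → Walk G l (combine i a) (combine i b)) (sym (Fin.toℕ-fromℕ< (s≤s l≤2)))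
          (fibre-walk i l w))
        (packing (combine i a) (combine i b) a∈ b∈ (a≢b ∘ Fin.combine-injectiveʳ i a i b) (Fin.fromℕ< (s≤s l≤2)))

  module _ (selector : ∀ i → ∃[ s ] IsUnusedSelector T R p i s) where
    private
      s : Fin k → Fin q
      s i = proj₁ (selector i)

      -- Such a port would put `j` into the list whose length is the load, which is 0.
      no-port : ∀ i j → ¬ Port i j (s i)
      no-port i j port with filter (λ j → port? i j (s i)) (allFin k) | proj₂ (selector i)
        | ∈-filter⁺ (λ j → port? i j (s i)) (∈-allFin j) port
      ... | [] | _ | ()

      selector-adj : ∀ i j b → G.Adj (combine i (s i)) (combine j b) → i ≡ j
      selector-adj i j b a with adj⇒fibreAdj i (s i) j b a
      ... | inj₁ (i≡j , _)  = i≡j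
      ... | inj₂ (port , _) = contradiction port (no-port i j)

      IsSelector : Fin (k * q) → Set
      IsSelector x = proj₂ (remQuot {k} q x) ≡ s (proj₁ (remQuot {k} q x))

      selectors : ∃[ S ] (∀ x → (x ∈ₛ S → IsSelector x) × (IsSelector x → x ∈ₛ S))
      selectors = comprehension (λ x → proj₂ (remQuot {k} q x) Fin.≟ s (proj₁ (remQuot {k} q x)))

    selector-set : Subset (k * q)
    selector-set = proj₁ selectors

    private
      combine∈⁻ : ∀ (i : Fin k) {a} → combine i a ∈ₛ selector-set → a ≡ s i
      combine∈⁻ i {a} x∈ = subst (λ (i , a) → a ≡ s i) (Fin.remQuot-combine i a)
        (proj₁ (proj₂ selectors (combine i a)) x∈)

      combine∈⁺ : ∀ i → combine i (s i) ∈ₛ selector-set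
      combine∈⁺ i = proj₂ (proj₂ selectors (combine i (s i)))
        (subst (λ (i , a) → a ≡ s i) (sym (Fin.remQuot-combine i (s i))) refl)

    ∣selector-set∣ : ∣ selector-set ∣ ≡ k
    ∣selector-set∣ = begin
      ∣ selector-set ∣
        ≡⟨ ∣∣≡∑ selector-set ⟩
      ∑[ x < k * q ] ⟦ x ∈? selector-set ⟧
        ≡⟨ ∑-combine k q (λ x → ⟦ x ∈? selector-set ⟧) ⟩
      ∑[ i < k ] ∑[ a < q ] ⟦ combine i a ∈? selector-set ⟧
        ≡⟨ sum-cong-≗ (λ i → count≡1 (λ a → combine i a ∈? selector-set) (combine∈⁺ i) (combine∈⁻ i)) ⟩
      ∑[ i < k ] 1
        ≡⟨ trans (∑-const k 1) (*-identityʳ k) ⟩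
      k ∎

    selector-set-packing : IsPacking G selector-set
    selector-set-packing u v u∈ v∈ u≢v
      with i , a , refl ← Fin.combine-surjective {k} u | j , b , refl ← Fin.combine-surjective {k} v
      with refl ← combine∈⁻ i u∈ | refl ← combine∈⁻ j v∈ = far
      where
      i≢j : i ≢ j
      i≢j refl = u≢v refl

      far : Dist≥ G 3 (combine i (s i)) (combine j (s j))
      far zero             eq           = u≢v eq
      far (suc zero)       (_ , a , refl) = i≢j (selector-adj i j (s j) a)
      -- A common neighbour would lie in the fibres of both selectors.
      far (suc (suc zero)) (w , a , _ , b , refl) with l , c , refl ← Fin.combine-surjective {k} w =
        i≢j (trans (selector-adj i l c a) (sym (selector-adj j l c (G.adj-sym b))))

-- Arithmetic of the bounds

-- Moves rational identities to unnormalised fractions, where equality is an integer identity after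
-- cross-multiplication.
fromℚᵘ-homo-+ : ∀ x y → fromℚᵘ x ℚ.+ fromℚᵘ y ≡ fromℚᵘ (x ℚᵘ.+ y)
fromℚᵘ-homo-+ x y = ℚ.toℚᵘ-injective (ℚᵘ.≃-trans (ℚ.toℚᵘ-homo-+ (fromℚᵘ x) (fromℚᵘ y))
  (ℚᵘ.≃-trans (ℚᵘ.+-cong (ℚ.toℚᵘ-fromℚᵘ x) (ℚ.toℚᵘ-fromℚᵘ y)) (ℚᵘ.≃-sym (ℚ.toℚᵘ-fromℚᵘ (x ℚᵘ.+ y)))))

fromℚᵘ-homo-- : ∀ x y → fromℚᵘ x ℚ.- fromℚᵘ y ≡ fromℚᵘ (x ℚᵘ.- y)
fromℚᵘ-homo-- x y = trans (cong (ℚ._+_ (fromℚᵘ x)) neg) (fromℚᵘ-homo-+ x (ℚᵘ.- y))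
  where
  neg : ℚ.- fromℚᵘ y ≡ fromℚᵘ (ℚᵘ.- y)
  neg = ℚ.toℚᵘ-injective (ℚᵘ.≃-trans (ℚ.toℚᵘ-homo‿- (fromℚᵘ y))
    (ℚᵘ.≃-trans (ℚᵘ.-‿cong (ℚ.toℚᵘ-fromℚᵘ y)) (ℚᵘ.≃-sym (ℚ.toℚᵘ-fromℚᵘ (ℚᵘ.- y)))))

half-sum : ∀ e m k → + 2 ℤ.* e ≡ m ℤ.+ + 2 ℤ.* k ℤ.- + 2 →
           e ℚ./ 1 ≡ m ℚ./ 2 ℚ.+ k ℚ./ 1 ℚ.- ℚ.1ℚ
half-sum e m k 2e≡ = begin
  fromℚᵘ (mkℚᵘ e 0)
    ≡⟨ ℚ.fromℚᵘ-cong {mkℚᵘ e 0} {mkℚᵘ m 1 ℚᵘ.+ mkℚᵘ k 0 ℚᵘ.- ℚᵘ.1ℚᵘ} (*≡* (trans (lhs e) (trans 2e≡ (rhs m k)))) ⟩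
  fromℚᵘ (mkℚᵘ m 1 ℚᵘ.+ mkℚᵘ k 0 ℚᵘ.- ℚᵘ.1ℚᵘ)
    ≡⟨ fromℚᵘ-homo-- (mkℚᵘ m 1 ℚᵘ.+ mkℚᵘ k 0) ℚᵘ.1ℚᵘ ⟨
  fromℚᵘ (mkℚᵘ m 1 ℚᵘ.+ mkℚᵘ k 0) ℚ.- ℚ.1ℚ
    ≡⟨ cong (ℚ._- ℚ.1ℚ) (fromℚᵘ-homo-+ (mkℚᵘ m 1) (mkℚᵘ k 0)) ⟨
  m ℚ./ 2 ℚ.+ k ℚ./ 1 ℚ.- ℚ.1ℚ ∎
  where
  lhs : ∀ e → e ℤ.* + 2 ≡ + 2 ℤ.* e
  lhs = solve-∀
  rhs : ∀ m k → m ℤ.+ + 2 ℤ.* k ℤ.- + 2 ≡ ((m ℤ.* + 1 ℤ.+ k ℤ.* + 2) ℤ.* + 1 ℤ.+ ℤ.- + 1 ℤ.* + 2) ℤ.* + 1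
  rhs = solve-∀

-- For `t` the cover number, `N` the numerator of `B-HY` and `d` the square of the maximum degree,
-- the left side of the hypothesis is `μ`.
difference-of-fraction : ∀ t N x d → N ℤ.- + suc d ℤ.* t ≡ ℤ.- x →
                         t ℚ./ 1 ℚ.- N ℚ./ suc d ≡ x ℚ./ suc d
difference-of-fraction t N x d eq = trans (fromℚᵘ-homo-- (mkℚᵘ t 0) (mkℚᵘ N d))
  (ℚ.fromℚᵘ-cong {mkℚᵘ t 0 ℚᵘ.- mkℚᵘ N d} {mkℚᵘ x d} (*≡* (begin
    (t ℤ.* + suc d ℤ.+ ℤ.- N ℤ.* + 1) ℤ.* + suc d
      ≡⟨ move t N (+ suc d) ⟩
    ℤ.- (N ℤ.- + suc d ℤ.* t) ℤ.* + suc d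
      ≡⟨ cong (λ y → ℤ.- y ℤ.* + suc d) eq ⟩
    ℤ.- (ℤ.- x) ℤ.* + suc d
      -- The common denominator `1 * suc d` computes to `suc d + 0`.
      ≡⟨ cong₂ ℤ._*_ (ℤ.neg-involutive x) (cong +_ (sym (+-identityʳ (suc d)))) ⟩
    x ℤ.* + (suc d + 0) ∎)))
  where
  move : ∀ t N m → (t ℤ.* m ℤ.+ ℤ.- N ℤ.* + 1) ℤ.* m ≡ ℤ.- (N ℤ.- m ℤ.* t) ℤ.* m
  move = solve-∀

pos-square : ∀ d → + (d ^ 2) ≡ + d ℤ.* + d
pos-square d = trans (cong (λ x → + (d * x)) (*-identityʳ d)) (ℤ.pos-* d d)

doubled-edge-count : ∀ e t m k → 2 * e ≡ m + 2 * t → t + 1 ≡ k → + 2 ℤ.* + e ≡ + m ℤ.+ + 2 ℤ.* + k ℤ.- + 2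
doubled-edge-count e t m .(t + 1) eq refl = begin
  + 2 ℤ.* + e                                  ≡⟨ ℤ.pos-* 2 e ⟨
  + (2 * e)                                    ≡⟨ cong +_ eq ⟩
  + (m + 2 * t)                                ≡⟨ cong (ℤ._+_ (+ m)) (ℤ.pos-* 2 t) ⟩
  + m ℤ.+ + 2 ℤ.* + t                          ≡⟨ add-one (+ m) (+ t) ⟩
  + m ℤ.+ + 2 ℤ.* (+ t ℤ.+ + 1) ℤ.- + 2        ∎
  where
  add-one : ∀ m t → m ℤ.+ + 2 ℤ.* t ≡ m ℤ.+ + 2 ℤ.* (t ℤ.+ + 1) ℤ.- + 2
  add-one = solve-∀

-- Positivity of `q` allows matching on a successor, so that `q ∸ 1` is exact and a polynomial
-- identity over the integers remains.
μ-identity : ∀ r L q k e → 1 ≤ q → + 2 ℤ.* + e ≡ + (r * q * k) ℤ.+ + 2 ℤ.* + k ℤ.- + 2 →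
  + (r + L) ℤ.* (+ (r + L) ℤ.- + 1) ℤ.* + (k * q) ℤ.+ + (2 * e) ℤ.- + (1 + (r + L) ^ 2) ℤ.* + ((q ∸ 1) * k)
    ≡ + k ℤ.* (+ ((r + L) ^ 2 + 3) ℤ.- + ((L + 1) * q)) ℤ.- + 2
μ-identity r L (suc q) k e _ 2e≡ = begin
  D ℤ.* (D ℤ.- + 1) ℤ.* + (k * suc q) ℤ.+ + (2 * e) ℤ.- + (1 + (r + L) ^ 2) ℤ.* + (q * k)
    ≡⟨ cong₂ ℤ._-_
         (cong₂ ℤ._+_ (cong (D ℤ.* (D ℤ.- + 1) ℤ.*_) (ℤ.pos-* k (suc q)))
           (trans (ℤ.pos-* 2 e) (trans 2e≡ (cong (λ x → x ℤ.+ + 2 ℤ.* + k ℤ.- + 2)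
             (trans (ℤ.pos-* (r * suc q) k) (cong (ℤ._* + k) (ℤ.pos-* r (suc q))))))))
         (cong₂ ℤ._*_ (cong (ℤ._+_ (+ 1)) (pos-square (r + L))) (ℤ.pos-* q k)) ⟩
  D ℤ.* (D ℤ.- + 1) ℤ.* (+ k ℤ.* (+ 1 ℤ.+ + q))
    ℤ.+ (+ r ℤ.* (+ 1 ℤ.+ + q) ℤ.* + k ℤ.+ + 2 ℤ.* + k ℤ.- + 2)
    ℤ.- (+ 1 ℤ.+ D ℤ.* D) ℤ.* (+ q ℤ.* + k)
    ≡⟨ identity (+ r) (+ L) (+ q) (+ k) ⟩
  + k ℤ.* ((D ℤ.* D ℤ.+ + 3) ℤ.- (+ L ℤ.+ + 1) ℤ.* (+ 1 ℤ.+ + q)) ℤ.- + 2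
    ≡⟨ cong₂ (λ x y → + k ℤ.* ((x ℤ.+ + 3) ℤ.- y) ℤ.- + 2)
         (pos-square (r + L)) (ℤ.pos-* (L + 1) (suc q)) ⟨
  + k ℤ.* (+ ((r + L) ^ 2 + 3) ℤ.- + ((L + 1) * suc q)) ℤ.- + 2 ∎
  where
  D = + (r + L)

  identity : ∀ r L q k →
    (r ℤ.+ L) ℤ.* ((r ℤ.+ L) ℤ.- + 1) ℤ.* (k ℤ.* (+ 1 ℤ.+ q))
      ℤ.+ (r ℤ.* (+ 1 ℤ.+ q) ℤ.* k ℤ.+ + 2 ℤ.* k ℤ.- + 2)
      ℤ.- (+ 1 ℤ.+ (r ℤ.+ L) ℤ.* (r ℤ.+ L)) ℤ.* (q ℤ.* k)
    ≡ k ℤ.* (((r ℤ.+ L) ℤ.* (r ℤ.+ L) ℤ.+ + 3) ℤ.- (L ℤ.+ + 1) ℤ.* (+ 1 ℤ.+ q)) ℤ.- + 2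
  identity = solve-∀

-- With `s` as `(r + L) ^ 2` and `b` as `(L + 1) * q`, this identifies the numerator of the final
-- fraction as the negative of `μ`.
negate-excess : ∀ k s b → k ℤ.* ((s ℤ.+ + 3) ℤ.- b) ℤ.- + 2 ≡ ℤ.- (k ℤ.* (b ℤ.- s ℤ.- + 3) ℤ.+ + 2)
negate-excess = solve-∀

theorem4p2 : (q r : ℕ) (R : Graph q) → Connected R → Regular R r → Diameter≤ R 2 →
    (k : ℕ) → 2 ≤ k → (T : Graph k) → IsTree T → (p : Ports T q) →
    (L : ℕ) → maxLoad T R p ≡ L →
    (∀ (i : Fin k) → ∃[ s ] IsUnusedSelector T R p i s) →
    let G = loadedTree T R p in
    Connected G
    × ∣V∣ G ≡ q * k
    × (+ ∣E∣ G) ℚ./ 1 ≡ (+ (r * q * k)) ℚ./ 2 ℚ.+ (+ k) ℚ./ 1 ℚ.- ℚ.1ℚ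
    × Δ G ≡ r + L
    × ρ G ≡ k
    × τD G ≡ (q ∸ 1) * k
    × μ G ≡ + k ℤ.* (+ ((r + L) ^ 2 + 3) ℤ.- + ((L + 1) * q)) ℤ.- + 2
    × (+ τD G) ℚ./ 1 ℚ.- B-HY G
    ≡ (+ k ℤ.* (+ ((L + 1) * q) ℤ.- + ((r + L) ^ 2) ℤ.- + 3) ℤ.+ + 2) ℚ./ (1 + (r + L) ^ 2)
theorem4p2 q r R connR regular diam k _ T tree@(connT , _) p L maxLoad≡L selector =
  connected-loadedTree T R p connT connR
  , *-comm k q
  , half-sum (+ ∣E∣ G) (+ (r * q * k)) (+ k) 2∣E∣≡
  , Δ≡
  , ρ-maximum G P packing ∣P∣≡k maximum
  , τ≡
  , μ≡
  -- `B-HY` has denominator `1 + Δ G ^ 2`, so `Δ G` is replaced by `r + L` only on the right, after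
  -- the subtraction.
  , subst (λ D → (+ τD G) ℚ./ 1 ℚ.- B-HY G ≡ excess ℚ./ (1 + D ^ 2)) Δ≡
      (difference-of-fraction (+ τD G) (HYnumerator G) excess (Δ G ^ 2)
        (trans μ≡ (negate-excess (+ k) (+ ((r + L) ^ 2)) (+ ((L + 1) * q)))))
  where
  G = loadedTree T R p
  P = selector-set T R p selector
  excess = + k ℤ.* (+ ((L + 1) * q) ℤ.- + ((r + L) ^ 2) ℤ.- + 3) ℤ.+ + 2

  packing : IsPacking G P
  packing = selector-set-packing T R p selector

  ∣P∣≡k : ∣ P ∣ ≡ k
  ∣P∣≡k = ∣selector-set∣ T R p selector

  maximum : ∀ Q → IsPacking G Q → ∣ Q ∣ ≤ k
  maximum = packing-bound T R p diam

  2∣E∣≡ : + 2 ℤ.* + ∣E∣ G ≡ + (r * q * k) ℤ.+ + 2 ℤ.* + k ℤ.- + 2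
  2∣E∣≡ = doubled-edge-count (∣E∣ G) (∣E∣ T) (r * q * k) k
    (∣E∣-loadedTree T R p regular) (tree-∣E∣ T tree)

  Δ≡ : Δ G ≡ r + L
  Δ≡ = trans (Δ-loadedTree T R p regular (proj₁ connT) (proj₁ connR)) (cong (_+_ r) maxLoad≡L)

  τ≡ : τD G ≡ (q ∸ 1) * k
  τ≡ = begin
    τD G             ≡⟨ τD-complement G P packing ∣P∣≡k maximum ⟩
    k * q ∸ k        ≡⟨ cong₂ _∸_ (*-comm k q) (sym (*-identityˡ k)) ⟩
    q * k ∸ 1 * k    ≡⟨ *-distribʳ-∸ k q 1 ⟨
    (q ∸ 1) * k      ∎

  μ≡ : μ G ≡ + k ℤ.* (+ ((r + L) ^ 2 + 3) ℤ.- + ((L + 1) * q)) ℤ.- + 2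
  μ≡ = trans
    (cong₂ (λ D t → + D ℤ.* (+ D ℤ.- + 1) ℤ.* + (k * q) ℤ.+ + (2 * ∣E∣ G) ℤ.- + (1 + D ^ 2) ℤ.* + t) Δ≡ τ≡)
    (μ-identity r L q k (∣E∣ G) (proj₁ connR) 2∣E∣≡)
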